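{- For every graph $G$ with $n$ vertices and $\mu$ maximal cliques, $$\frac{\mu}{2n}-1\le b_H(G)\le \mu-1.$$
   Context: A grid is the set of integer points of the plane; a grid edge joins two grid points at distance $1$. A path in the grid is a sequence of distinct grid edges in which consecutive edges share exactly one grid point and non-consecutive edges share none; a bend is a pair of consecutive edges of the path with different directions (horizontal/vertical). An EPG representation of a graph $G$ is a family $(P_v)_{v\in V(G)}$ of grid paths such that distinct $u,v$ are adjacent iff $P_u,P_v$ share a grid edge; it is a $B_k$-EPG representation if every path has at most $k$ bends. It is Helly if every subfamily of pairwise edge-intersecting paths has a grid edge common to all its members. The Helly-bend number $b_H(G)$ is the smallest $k$ such that $G$ admits a Helly $B_k$-EPG representation. -}

module Defs where

open import Data.Bool using (if_then_else_)
open import Data.Fin using (Fin; toℕ)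
open import Data.Fin.Properties using (all?) renaming (_≟_ to _≟ᶠ_)
open import Data.Fin.Subset using (Subset; inside; outside; _∈_; _⊆_)
open import Data.Fin.Subset.Properties using (_∈?_; _⊆?_; anySubset?)
open import Data.Integer using (ℤ) renaming (suc to sucℤ)
open import Data.List using (List; []; _∷_; _++_; map; filter; length; lookup)
import Data.List.Membership.Propositional as List
open import Data.List.Relation.Unary.Unique.Propositional using (Unique)
open import Data.Nat using (ℕ; zero; suc; _+_; _≤_; _<_)
open import Data.Product using (Σ; ∃; ∃!; _×_; _,_)
open import Data.Sum using (_⊎_)
open import Data.Vec using ([]; _∷_)
open import Function using (_⇔_)
open import Level using (0ℓ)
open import Relation.Binary using (Rel; Symmetric; Decidable)
open import Relation.Binary.PropositionalEquality using (_≡_; _≢_; refl)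
open import Relation.Nullary using (¬_; Dec; yes; no; does)
open import Relation.Nullary.Decidable using (map′; ¬?; decidable-stable; _×-dec_; _→-dec_)
import Relation.Unary as U

record Graph (n : ℕ) : Set₁ where
  field
    _~_    : Rel (Fin n) 0ℓ
    _~?_   : Decidable _~_
    ~-sym  : Symmetric _~_
    ~-irr  : ∀ {v} → ¬ (v ~ v)

module _ {n : ℕ} (G : Graph n) where
  open Graph G

  IsClique : Subset n → Set
  IsClique S = ∀ u v → u ∈ S → v ∈ S → u ≢ v → u ~ v

  IsMaximalClique : Subset n → Set
  IsMaximalClique S = IsClique S × (∀ T → IsClique T → S ⊆ T → T ⊆ S)

  isClique? : U.Decidable IsClique
  isClique? S = all? λ u → all? λ v →
    (u ∈? S) →-dec (v ∈? S) →-dec ¬? (u ≟ᶠ v) →-dec (u ~? v)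

  isMaximalClique? : U.Decidable IsMaximalClique
  isMaximalClique? S = isClique? S ×-dec map′
    (λ noBigger T cT S⊆T →
      decidable-stable (T ⊆? S) λ T⊈S → noBigger (T , cT , (λ {_} → S⊆T) , T⊈S))
    (λ { max (T , cT , S⊆T , T⊈S) → T⊈S (max T cT S⊆T) })
    (¬? (anySubset? λ T → isClique? T ×-dec (S ⊆? T) ×-dec ¬? (T ⊆? S)))

-- Every subset occurs exactly once in this list.
allSubsets : ∀ n → List (Subset n)
allSubsets zero    = [] ∷ []
allSubsets (suc n) = map (outside ∷_) (allSubsets n) ++ map (inside ∷_) (allSubsets n)

maximalCliques : ∀ {n} → Graph n → List (Subset n)
maximalCliques {n} G = filter (isMaximalClique? G) (allSubsets n)

μ : ∀ {n} → Graph n → ℕ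
μ G = length (maximalCliques G)

GridPoint : Set
GridPoint = ℤ × ℤ

data Direction : Set where
  horizontal vertical : Direction

_≟ᵈ_ : (d d′ : Direction) → Dec (d ≡ d′)
horizontal ≟ᵈ horizontal = yes refl
horizontal ≟ᵈ vertical   = no λ ()
vertical   ≟ᵈ horizontal = no λ ()
vertical   ≟ᵈ vertical   = yes refl

-- The unordered pair of grid points at distance 1 is stored as its left
-- (or lower) endpoint and its direction, so that each grid edge has exactly
-- one representative and equality of edges is _≡_.
record GridEdge : Set where
  constructor gridEdge
  field
    direction : Direction
    start     : GridPoint

open GridEdge public

end : GridEdge → GridPoint
end (gridEdge horizontal (x , y)) = sucℤ x , y
end (gridEdge vertical   (x , y)) = x , sucℤ y

_∈ᵉ_ : GridPoint → GridEdge → Set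
p ∈ᵉ e = p ≡ start e ⊎ p ≡ end e

record GridPath : Set where
  field
    edges          : List GridEdge
    distinct       : Unique edges
    consecutive    : ∀ i j → toℕ j ≡ suc (toℕ i) →
                     ∃! _≡_ λ p → p ∈ᵉ lookup edges i × p ∈ᵉ lookup edges j
    nonConsecutive : ∀ i j → suc (toℕ i) < toℕ j →
                     ¬ (∃ λ p → p ∈ᵉ lookup edges i × p ∈ᵉ lookup edges j)

open GridPath public

countBends : List GridEdge → ℕ
countBends []           = 0
countBends (_ ∷ [])     = 0
countBends (e ∷ f ∷ es) =
  (if does (direction e ≟ᵈ direction f) then 0 else 1) + countBends (f ∷ es)

bends : GridPath → ℕ
bends P = countBends (edges P)

_∈ᵖ_ : GridEdge → GridPath → Set
e ∈ᵖ P = e List.∈ edges P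

ShareEdge : GridPath → GridPath → Set
ShareEdge P Q = ∃ λ e → e ∈ᵖ P × e ∈ᵖ Q

record EPGRepresentation {n : ℕ} (G : Graph n) : Set where
  open Graph G
  field
    path     : Fin n → GridPath
    adjacent : ∀ u v → u ≢ v → (u ~ v) ⇔ ShareEdge (path u) (path v)

open EPGRepresentation public

module _ {n : ℕ} {G : Graph n} (R : EPGRepresentation G) where

  IsB : ℕ → Set
  IsB k = ∀ v → bends (path R v) ≤ k

  -- Subfamilies are indexed by sets of vertices. In particular a one-member
  -- subfamily must have a common edge, so no path is the empty sequence.
  IsHelly : Set
  IsHelly = ∀ (S : Subset n) →
    (∀ u v → u ∈ S → v ∈ S → u ≢ v → ShareEdge (path R u) (path R v)) →
    ∃ λ e → ∀ v → v ∈ S → e ∈ᵖ path R v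

HasHellyB : ∀ {n} → Graph n → ℕ → Set
HasHellyB G k = Σ (EPGRepresentation G) λ R → IsB R k × IsHelly R

-- b_H(G) = b. A least element is unique, so this relation is a partial
-- function of G.
IsHellyBendNumber : ∀ {n} → Graph n → ℕ → Set
IsHellyBendNumber G b = HasHellyB G b × (∀ k → HasHellyB G k → b ≤ k)

{-# OPTIONS --safe #-}

-- Lower bound: in a Helly representation the members of a maximal clique C have
-- a common edge, and an edge common to C determines C, because all paths through
-- an edge are pairwise adjacent. Replace the common edge by the predecessor on its
-- line as long as that is still common to C; the process stops at an edge whose
-- predecessor is missing from the path of some member, and such an edge is the
-- first or last one of a straight run of that path. A path with at most k bends
-- has at most 2(k + 1) such run ends.
--
-- Upper bound: every vertex gets a monotone staircase with μ runs, one for each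
-- maximal clique. Run j of v lies on a line reserved for the j-th clique C if
-- v ∈ C, and on a line used by no other run otherwise. So only vertices with a
-- common clique share edges, and the runs of all members of C overlap.

module Submission where

open import Defs
import Algebra.Properties.CommutativeSemigroup as CommutativeSemigroup
open import Data.Fin using (Fin; zero; suc; toℕ)
open import Data.Fin.Properties using (¬∀⟶∃¬; injective⇒≤; all?; toℕ<n; toℕ-injective)
open import Data.Fin.Subset using (Subset; inside; outside; _∈_; _⊆_; _∪_; ⊥; ⁅_⁆)
open import Data.Fin.Subset.Induction using (⊃-wellFounded; Acc; acc)
open import Data.Fin.Subset.Properties
  using (_∈?_; anySubset?; _⊂?_; nonempty?; ⊆-antisym; x∈⁅x⁆; x∈⁅y⁆⇒x≡y; ∉⊥; p⊆p∪q; q⊆p∪q; x∈p∪q⁻)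
open import Data.Integer as ℤ using (ℤ; +_) renaming (suc to sucℤ; pred to predℤ)
import Data.Integer.Properties as ℤ
open import Data.List using (List; []; _∷_; map; filter; length; lookup; concatMap; allFin)
open import Data.List.Extrema ℤ.≤-totalOrder using (argmin; argmin-all; f[argmin]≤f[xs])
import Data.List.Membership.DecPropositional as DecMembership
import Data.List.Membership.Propositional as List
open import Data.List.Membership.Propositional.Properties
  using (∈-filter⁺; ∈-filter⁻; ∈-lookup; ∈-length; ∈-map⁺; ∈-map⁻; ∈-++⁺ˡ; ∈-++⁺ʳ; ∈-concatMap⁺; ∈-allFin)
import Data.List.Membership.Setoid.Properties as SetoidMembership
open import Data.List.Properties using (length-++; length-tabulate)
open import Data.List.Relation.Unary.All as All using ([]; _∷_)
open import Data.List.Relation.Unary.AllPairs using ([]; _∷_)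
open import Data.List.Relation.Unary.Any as Any using (here; there)
open import Data.List.Relation.Unary.Linked using (Linked; []; [-]; _∷_)
open import Data.List.Relation.Unary.Unique.Propositional using (Unique)
import Data.List.Relation.Unary.Unique.Propositional.Properties as Unique
open import Data.Nat as ℕ using (ℕ; zero; suc; _+_; _*_; _∸_; _<_; z≤n; s≤s; NonZero)
open import Data.Nat.DivMod using (_%_; [m+kn]%n≡m%n; m<n⇒m%n≡m)
import Data.Nat.Properties as ℕ
open import Data.Nat.Properties using (m*n≢0)
open import Data.Product using (∃; _×_; _,_; proj₁; proj₂)
open import Data.Product.Properties using (≡-dec)
open import Data.Rational as ℚ using (1ℚ; _/_; _-_; _≤_)
import Data.Rational.Properties as ℚ
import Data.Rational.Unnormalised as ℚᵘ
import Data.Rational.Unnormalised.Properties as ℚᵘ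
open import Data.Sum using (_⊎_; inj₁; inj₂)
open import Data.Vec using ([]; _∷_)
open import Data.Vec.Properties using (∷-injectiveʳ)
open import Function using (_∘_; id; mk⇔; Equivalence)
open import Relation.Binary.PropositionalEquality
open import Relation.Nullary using (¬_; Dec; yes; no; contradiction)
open import Relation.Nullary.Decidable using (map′; _×-dec_; _→-dec_; decidable-stable)
open import Relation.Unary using (Decidable)

open CommutativeSemigroup ℤ.+-commutativeSemigroup using (x∙yz≈y∙xz)

-- Comparing lengths of lists

Unique⇒lookup-injective : ∀ {A : Set} {xs : List A} → Unique xs →
  ∀ i j → lookup xs i ≡ lookup xs j → i ≡ j
Unique⇒lookup-injective (_    ∷ _)  zero    zero    _  = refl
Unique⇒lookup-injective (x∉xs ∷ _)  zero    (suc j) eq =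
  contradiction eq (All.lookup x∉xs (∈-lookup j))
Unique⇒lookup-injective (x∉xs ∷ _)  (suc i) zero    eq =
  contradiction (sym eq) (All.lookup x∉xs (∈-lookup i))
Unique⇒lookup-injective (_    ∷ ux) (suc i) (suc j) eq =
  cong suc (Unique⇒lookup-injective ux i j eq)

-- Each index of `xs` is sent to the index of a chosen related entry of `ys`, and `inj` makes this
-- map between finite sets injective. A relation is used because one clique may be realised by
-- several run ends.
length-≤-of-injective : ∀ {A B : Set} {xs : List A} {ys : List B} (R : A → B → Set) →
  (∀ {x x′ y} → R x y → R x′ y → x ≡ x′) → Unique xs →
  (∀ {x} → x List.∈ xs → ∃ λ y → y List.∈ ys × R x y) → length xs ℕ.≤ length ys
length-≤-of-injective {xs = xs} {ys} R inj ux image = injective⇒≤ index-injective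
  where
  target : ∀ i → ∃ λ y → y List.∈ ys × R (lookup xs i) y
  target i = image (∈-lookup i)

  index-injective : ∀ {i j} →
    Any.index (proj₁ (proj₂ (target i))) ≡ Any.index (proj₁ (proj₂ (target j))) → i ≡ j
  index-injective {i} {j} eq with target i | target j
  ... | y , y∈ , Ry | z , z∈ , Rz =
    Unique⇒lookup-injective ux i j
      (inj Ry (subst (R _) (sym (SetoidMembership.index-injective (setoid _) y∈ z∈ eq)) Rz))

length-concatMap-≤ : ∀ {A B : Set} {f : A → List B} {m} → (∀ x → length (f x) ℕ.≤ m) →
  ∀ xs → length (concatMap f xs) ℕ.≤ length xs * m
length-concatMap-≤         bound []       = z≤n
length-concatMap-≤ {f = f} bound (x ∷ xs)
  rewrite length-++ (f x) {concatMap f xs} =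
  ℕ.+-mono-≤ (bound x) (length-concatMap-≤ bound xs)

-- Rational form of the bounds

-- `_/_` reduces to lowest terms through a gcd, so the sum is evaluated among unnormalised
-- fractions, where it is plain integer arithmetic.
1+[b/1]≡[1+b]/1 : ∀ b → 1ℚ ℚ.+ (+ b / 1) ≡ + suc b / 1
1+[b/1]≡[1+b]/1 b = ℚ.toℚᵘ-injective (begin-equality
  ℚ.toℚᵘ (1ℚ ℚ.+ (+ b / 1))          ≃⟨ ℚ.toℚᵘ-homo-+ 1ℚ (+ b / 1) ⟩
  ℚᵘ.1ℚᵘ ℚᵘ.+ ℚ.toℚᵘ (+ b / 1)       ≃⟨ ℚᵘ.+-congʳ ℚᵘ.1ℚᵘ (ℚ.toℚᵘ-fromℚᵘ (ℚᵘ.mkℚᵘ (+ b) 0)) ⟩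
  ℚᵘ.1ℚᵘ ℚᵘ.+ ℚᵘ.mkℚᵘ (+ b) 0          ≃⟨ ℚᵘ.*≡* (cong (λ i → (+ 1 ℤ.+ i) ℤ.* + 1) (ℤ.*-identityʳ (+ b))) ⟩
  ℚᵘ.mkℚᵘ (+ suc b) 0                  ≃⟨ ℚ.toℚᵘ-fromℚᵘ (ℚᵘ.mkℚᵘ (+ suc b) 0) ⟨
  ℚ.toℚᵘ (+ suc b / 1)               ∎)
  where open ℚᵘ.≤-Reasoning

/-mono-≤ : ∀ a b m d .{{_ : NonZero m}} .{{_ : NonZero d}} →
  a * d ℕ.≤ b * m → (+ a / m) ≤ (+ b / d)
/-mono-≤ a b (suc m) (suc d) ad≤bm = ℚ.toℚᵘ-cancel-≤ (begin
  ℚ.toℚᵘ (+ a / suc m)   ≃⟨ ℚ.toℚᵘ-fromℚᵘ (ℚᵘ.mkℚᵘ (+ a) m) ⟩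
  ℚᵘ.mkℚᵘ (+ a) m          ≤⟨ ℚᵘ.*≤* (subst₂ ℤ._≤_ (ℤ.pos-* a _) (ℤ.pos-* b _) (ℤ.+≤+ ad≤bm)) ⟩
  ℚᵘ.mkℚᵘ (+ b) d          ≃⟨ ℚ.toℚᵘ-fromℚᵘ (ℚᵘ.mkℚᵘ (+ b) d) ⟨
  ℚ.toℚᵘ (+ b / suc d)   ∎)
  where open ℚᵘ.≤-Reasoning

r+q-r≡q : ∀ r q → (r ℚ.+ q) - r ≡ q
r+q-r≡q r q = begin
  (r ℚ.+ q) - r       ≡⟨ cong (_- r) (ℚ.+-comm r q) ⟩
  (q ℚ.+ r) - r       ≡⟨ ℚ.+-assoc q r (ℚ.- r) ⟩
  q ℚ.+ (r - r)       ≡⟨ cong (q ℚ.+_) (ℚ.+-inverseʳ r) ⟩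
  q ℚ.+ ℚ.0ℚ            ≡⟨ ℚ.+-identityʳ q ⟩
  q                     ∎
  where open ≡-Reasoning

p≤1+q⇒p-1≤q : ∀ {p q} → p ≤ 1ℚ ℚ.+ q → p - 1ℚ ≤ q
p≤1+q⇒p-1≤q {p} {q} p≤1+q =
  subst (p - 1ℚ ≤_) (r+q-r≡q 1ℚ q) (ℚ.+-monoˡ-≤ (ℚ.- 1ℚ) p≤1+q)

1+q≤p⇒q≤p-1 : ∀ {p q} → 1ℚ ℚ.+ q ≤ p → q ≤ p - 1ℚ
1+q≤p⇒q≤p-1 {p} {q} 1+q≤p =
  subst (_≤ p - 1ℚ) (r+q-r≡q 1ℚ q) (ℚ.+-monoˡ-≤ (ℚ.- 1ℚ) 1+q≤p)

-- Maximal cliques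

∈-allSubsets : ∀ {n} (S : Subset n) → S List.∈ allSubsets n
∈-allSubsets []        = here refl
∈-allSubsets (outside ∷ S) = ∈-++⁺ˡ (∈-map⁺ (outside ∷_) (∈-allSubsets S))
∈-allSubsets (inside  ∷ S) = ∈-++⁺ʳ _ (∈-map⁺ (inside ∷_) (∈-allSubsets S))

allSubsets-unique : ∀ n → Unique (allSubsets n)
allSubsets-unique zero    = [] ∷ []
allSubsets-unique (suc n) =
  Unique.++⁺ (Unique.map⁺ ∷-injectiveʳ ih) (Unique.map⁺ ∷-injectiveʳ ih) disjoint
  where
  ih = allSubsets-unique n
  disjoint : ∀ {S} → ¬ (S List.∈ map (outside ∷_) (allSubsets n) ×
                        S List.∈ map (inside ∷_) (allSubsets n))
  disjoint (o , i) with ∈-map⁻ (outside ∷_) o | ∈-map⁻ (inside ∷_) i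
  ... | _ , _ , refl | _ , _ , ()

module _ {n : ℕ} (G : Graph n) where

  maximalCliques-unique : Unique (maximalCliques G)
  maximalCliques-unique = Unique.filter⁺ (isMaximalClique? G) (allSubsets-unique n)

  ∈-maximalCliques⁻ : ∀ {S} → S List.∈ maximalCliques G → IsMaximalClique G S
  ∈-maximalCliques⁻ = proj₂ ∘ ∈-filter⁻ (isMaximalClique? G) {xs = allSubsets n}

  -- As long as a strictly larger clique exists, pass to it; strict inclusion of subsets of a finite
  -- set cannot ascend forever.
  extendClique : ∀ S → IsClique G S → ∃ λ C → C List.∈ maximalCliques G × S ⊆ C
  extendClique S cS = go S cS (⊃-wellFounded S)
    where
    go : ∀ S → IsClique G S → Acc _ S → ∃ λ C → C List.∈ maximalCliques G × S ⊆ C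
    go S cS (acc larger) with anySubset? (λ T → isClique? G T ×-dec (S ⊂? T))
    ... | yes (T , cT , S⊂T) with go T cT (larger S⊂T)
    ...   | C , C∈ , T⊆C = C , C∈ , λ {_} → T⊆C ∘ proj₁ S⊂T
    go S cS (acc larger) | no none =
      S , ∈-filter⁺ (isMaximalClique? G) (∈-allSubsets S) (cS , maximal) , λ {_} x∈S → x∈S
      where
      maximal : ∀ T → IsClique G T → S ⊆ T → T ⊆ S
      maximal T cT S⊆T {x} x∈T =
        decidable-stable (x ∈? S) λ x∉S → none (T , cT , (λ {_} → S⊆T) , x , x∈T , x∉S)

  ⁅⁆-isClique : ∀ v → IsClique G ⁅ v ⁆
  ⁅⁆-isClique v x y x∈ y∈ x≢y =
    contradiction (trans (x∈⁅y⁆⇒x≡y v x∈) (sym (x∈⁅y⁆⇒x≡y v y∈))) x≢y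

  ⊥-isClique : IsClique G ⊥
  ⊥-isClique _ _ x∈⊥ = contradiction x∈⊥ ∉⊥

  maximalClique-nonempty : ∀ {C} → Fin n → IsMaximalClique G C → ∃ λ v → v ∈ C
  maximalClique-nonempty {C} v (_ , max) with nonempty? C
  ... | yes ne = ne
  -- An empty `C` is contained in the clique `⁅ v ⁆`, so maximality puts `v` into `C`.
  ... | no  ¬ne = v , max ⁅ v ⁆ (⁅⁆-isClique v) (λ {x} x∈C → contradiction (x , x∈C) ¬ne) (x∈⁅x⁆ v)

-- Runs of a path

back : Direction → GridPoint → GridPoint
back horizontal (x , y) = predℤ x , y
back vertical   (x , y) = x , predℤ y

predecessor : GridEdge → GridEdge
predecessor (gridEdge d p) = gridEdge d (back d p)

back-end : ∀ d p → back d (end (gridEdge d p)) ≡ p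
back-end horizontal (x , y) = cong (_, y) (ℤ.pred-suc x)
back-end vertical   (x , y) = cong (x ,_) (ℤ.pred-suc y)

end-predecessor : ∀ e → end (predecessor e) ≡ start e
end-predecessor (gridEdge horizontal (x , y)) = cong (_, y) (ℤ.suc-pred x)
end-predecessor (gridEdge vertical   (x , y)) = cong (x ,_) (ℤ.suc-pred y)

-- A potential that grows by one from `start` to `end` in both directions. It drives the descent to
-- a lowest common edge and later orders the edges of a walk.
height : GridPoint → ℤ
height (x , y) = x ℤ.+ y

height-back : ∀ d p → height (back d p) ≡ predℤ (height p)
height-back horizontal (x , y) = ℤ.+-assoc ℤ.-1ℤ x y
height-back vertical   (x , y) = x∙yz≈y∙xz x ℤ.-1ℤ y

height-end : ∀ e → height (end e) ≡ sucℤ (height (start e))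
height-end (gridEdge horizontal (x , y)) = ℤ.+-assoc ℤ.1ℤ x y
height-end (gridEdge vertical   (x , y)) = x∙yz≈y∙xz x ℤ.1ℤ y

height-predecessor : ∀ e → height (start (predecessor e)) ℤ.< height (start e)
height-predecessor (gridEdge d p) = ℤ.i≤pred[j]⇒i<j (ℤ.≤-reflexive (height-back d p))

Meets : GridEdge → GridEdge → Set
Meets e f = ∃ λ p → p ∈ᵉ e × p ∈ᵉ f

-- Two endpoints can coincide in four ways. For parallel edges a common start or a common end forces
-- equality, and the two mixed ways are the two alternatives.
collinear-meets⇒predecessor : ∀ {e f} → direction e ≡ direction f → e ≢ f → Meets e f →
  e ≡ predecessor f ⊎ f ≡ predecessor e
collinear-meets⇒predecessor {gridEdge d p} {gridEdge d q} refl e≢f (_ , inj₁ refl , inj₁ refl) =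
  contradiction refl e≢f
collinear-meets⇒predecessor {gridEdge d p} {gridEdge d q} refl e≢f (_ , inj₁ refl , inj₂ refl) =
  inj₂ (cong (gridEdge d) (sym (back-end d q)))
collinear-meets⇒predecessor {gridEdge d p} {gridEdge d q} refl e≢f (_ , inj₂ refl , inj₁ refl) =
  inj₁ (cong (gridEdge d) (sym (back-end d p)))
collinear-meets⇒predecessor {gridEdge d p} {gridEdge d q} refl e≢f (_ , inj₂ refl , inj₂ eq) =
  contradiction (cong (gridEdge d) p≡q) e≢f
  where
  p≡q : p ≡ q
  p≡q = trans (sym (back-end d p)) (trans (cong (back d) eq) (back-end d q))

predecessor-injective : ∀ {e f} → direction e ≡ direction f →
  predecessor e ≡ predecessor f → e ≡ f
predecessor-injective {e} {f} refl eq = cong (gridEdge (direction e))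
  (trans (sym (end-predecessor e)) (trans (cong end eq) (end-predecessor f)))

edges-linked : ∀ P → Linked Meets (edges P)
edges-linked P = go (edges P) λ i j j≡1+i → let p , p∈ , _ = consecutive P i j j≡1+i in p , p∈
  where
  go : ∀ es → (∀ i j → toℕ j ≡ suc (toℕ i) → Meets (lookup es i) (lookup es j)) → Linked Meets es
  go []           _     = []
  go (_ ∷ [])     _     = [-]
  go (_ ∷ f ∷ es) meets =
    meets zero (suc zero) refl ∷ go (f ∷ es) λ i j eq → meets (suc i) (suc j) (cong suc eq)

-- A run is a maximal sublist of consecutive edges of the same direction. Its
-- first and last edges are both listed, even if they coincide.
runEndsAfter : GridEdge → List GridEdge → List GridEdge
runEndsAfter e []       = e ∷ []
runEndsAfter e (f ∷ es) with direction e ≟ᵈ direction f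
... | yes _ = runEndsAfter f es
... | no  _ = e ∷ f ∷ runEndsAfter f es

runEnds : List GridEdge → List GridEdge
runEnds []       = []
runEnds (e ∷ es) = e ∷ runEndsAfter e es

-- Every bend closes one run and opens the next, which lists two edges; the last edge of the path
-- closes the final run.
length-runEndsAfter : ∀ e es → length (runEndsAfter e es) ≡ suc (2 * countBends (e ∷ es))
length-runEndsAfter e []       = refl
length-runEndsAfter e (f ∷ es) with direction e ≟ᵈ direction f
... | yes _ = length-runEndsAfter f es
... | no  _ = cong suc (trans (cong suc (length-runEndsAfter f es))
                              (sym (ℕ.*-suc 2 (countBends (f ∷ es)))))

length-runEnds : ∀ es → length (runEnds es) ℕ.≤ 2 * suc (countBends es)
length-runEnds []       = z≤n
length-runEnds (e ∷ es) = ℕ.≤-reflexive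
  (trans (cong suc (length-runEndsAfter e es)) (sym (ℕ.*-suc 2 (countBends (e ∷ es)))))

mutual
  -- The path may traverse a run in either sense, so the predecessor of an inner edge `e` is sought
  -- on both sides. If neither neighbour `a` nor `f` were it, `e` would be the predecessor of both;
  -- then `a` and `f` would be equal, against distinctness.
  ∈-runEndsAfter : ∀ {a e es g} → Unique (a ∷ e ∷ es) → Linked Meets (a ∷ e ∷ es) →
    direction a ≡ direction e → g List.∈ e ∷ es →
    g List.∈ runEndsAfter e es ⊎ predecessor g List.∈ a ∷ e ∷ es
  ∈-runEndsAfter {es = []} _ _ _ (here refl) = inj₁ (here refl)
  ∈-runEndsAfter {e = e} {es = f ∷ es} _ _ _ _ with direction e ≟ᵈ direction f
  ∈-runEndsAfter {es = f ∷ es} ((a≢e ∷ a≢f ∷ _) ∷ (e≢f ∷ _) ∷ _) (ae ∷ ef ∷ _) a∥e (here refl)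
    | yes e∥f with collinear-meets⇒predecessor a∥e a≢e ae | collinear-meets⇒predecessor e∥f e≢f ef
  ... | inj₁ refl | _         = inj₂ (here refl)
  ... | inj₂ _    | inj₂ refl = inj₂ (there (there (here refl)))
  ... | inj₂ e≡a- | inj₁ e≡f- = contradiction (predecessor-injective a∥f (trans (sym e≡a-) e≡f-)) a≢f
    where a∥f = trans a∥e e∥f
  ∈-runEndsAfter (_ ∷ u) (_ ∷ l) _ (there g∈) | yes e∥f
    with ∈-runEndsAfter u l e∥f g∈
  ... | inj₁ g∈ends = inj₁ g∈ends
  ... | inj₂ g-∈    = inj₂ (there g-∈)
  ∈-runEndsAfter _ _ _ (here refl) | no _ = inj₁ (here refl)
  ∈-runEndsAfter (_ ∷ _ ∷ u) (_ ∷ _ ∷ l) _ (there g∈) | no _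
    with ∈-runEnds u l g∈
  ... | inj₁ g∈ends = inj₁ (there g∈ends)
  ... | inj₂ g-∈    = inj₂ (there (there g-∈))

  ∈-runEnds : ∀ {es g} → Unique es → Linked Meets es → g List.∈ es →
    g List.∈ runEnds es ⊎ predecessor g List.∈ es
  ∈-runEnds _ _ (here refl) = inj₁ (here refl)
  ∈-runEnds {e ∷ f ∷ es} _ _ (there _) with direction e ≟ᵈ direction f
  ∈-runEnds u l (there g∈) | yes e∥f with ∈-runEndsAfter u l e∥f g∈
  ... | inj₁ g∈ends = inj₁ (there g∈ends)
  ... | inj₂ g-∈    = inj₂ g-∈
  ∈-runEnds (_ ∷ u) (_ ∷ l) (there g∈) | no _ with ∈-runEnds u l g∈
  ... | inj₁ g∈ends = inj₁ (there (there g∈ends))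
  ... | inj₂ g-∈    = inj₂ (there g-∈)

-- Common edges of cliques and the lower bound

_≟ᵉ_ : (e f : GridEdge) → Dec (e ≡ f)
gridEdge d p ≟ᵉ gridEdge d′ p′ =
  map′ (λ { (refl , refl) → refl }) (λ { refl → refl , refl })
    ((d ≟ᵈ d′) ×-dec ≡-dec ℤ._≟_ ℤ._≟_ p p′)

open DecMembership _≟ᵉ_ using () renaming (_∈?_ to _∈ᵉ?_)

module _ {n : ℕ} {G : Graph n} (R : EPGRepresentation G) where
  open Graph G

  Common : Subset n → GridEdge → Set
  Common S e = ∀ v → v ∈ S → e ∈ᵖ path R v

  through? : ∀ S e → Decidable (λ v → v ∈ S → e ∈ᵖ path R v)
  through? S e v = (v ∈? S) →-dec (e ∈ᵉ? edges (path R v))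

  common? : ∀ S → Decidable (Common S)
  common? S e = all? (through? S e)

  -- The lowest edge common to all members ends a run of some member, since
  -- otherwise its predecessor would be common as well.
  common-runEnd : ∀ {S v e} → v ∈ S → Common S e →
    ∃ λ f → Common S f × ∃ λ u → f List.∈ runEnds (edges (path R u))
  common-runEnd {S} {v} {e} v∈S e-common = lowest , lowest-common , member
    where
    -- All common edges lie on the path of the member `v`, so this finite list contains every one of
    -- them; the default `e` of `argmin` is common too.
    candidates = filter (common? S) (edges (path R v))
    lowest = argmin (height ∘ start) e candidates

    lowest-common : Common S lowest
    lowest-common = argmin-all (height ∘ start) e-common
      (All.tabulate (proj₂ ∘ ∈-filter⁻ (common? S) {xs = edges (path R v)}))

    pred-not-common : ¬ Common S (predecessor lowest)
    pred-not-common c = ℤ.<⇒≱ (height-predecessor lowest)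
      (All.lookup (f[argmin]≤f[xs] {f = height ∘ start} e candidates) (∈-filter⁺ (common? S) (c v v∈S) c))

    member : ∃ λ u → lowest List.∈ runEnds (edges (path R u))
    member with ¬∀⟶∃¬ n _ (through? S (predecessor lowest)) pred-not-common
    ... | u , pred∉ with u ∈? S
    ...   | no  u∉S = contradiction (λ u∈S → contradiction u∈S u∉S) pred∉
    ...   | yes u∈S with ∈-runEnds (distinct (path R u)) (edges-linked (path R u)) (lowest-common u u∈S)
    ...     | inj₁ end∈  = u , end∈
    ...     | inj₂ pred∈ = contradiction (λ _ → pred∈) pred∉

  common-determines : ∀ {C D e} → IsMaximalClique G C → IsMaximalClique G D →
    Common C e → Common D e → D ⊆ C
  common-determines {C} {D} {e} (cC , maxC) (cD , _) eC eD {x} x∈D =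
    maxC (C ∪ D) clique (p⊆p∪q D) (q⊆p∪q C D x∈D)
    where
    through : ∀ {v} → v ∈ C ∪ D → e ∈ᵖ path R v
    through {v} v∈ with x∈p∪q⁻ C D v∈
    ... | inj₁ v∈C = eC v v∈C
    ... | inj₂ v∈D = eD v v∈D

    clique : IsClique G (C ∪ D)
    clique u v u∈ v∈ u≢v =
      Equivalence.from (adjacent R u v u≢v) (e , through u∈ , through v∈)

  -- The Helly property gives each maximal clique a common edge, which is moved to a run end, and no
  -- run end serves two cliques. A vertex is required: for `n = 0` the empty set is a maximal
  -- clique, but there are no run ends.
  μ≤2n[k+1] : ∀ {k} → Fin n → IsB R k → IsHelly R → μ G ℕ.≤ 2 * n * suc k
  μ≤2n[k+1] {k} v₀ isB helly = begin
    μ G                  ≤⟨ length-≤-of-injective Realises realises-injective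
                              (maximalCliques-unique G) realised ⟩
    length allRunEnds    ≤⟨ length-concatMap-≤ few-runEnds (allFin n) ⟩
    length (allFin n) * (2 * suc k)   ≡⟨ cong (_* (2 * suc k)) (length-tabulate {n = n} id) ⟩
    n * (2 * suc k)      ≡⟨ ℕ.*-assoc n 2 (suc k) ⟨
    n * 2 * suc k        ≡⟨ cong (_* suc k) (ℕ.*-comm n 2) ⟩
    2 * n * suc k        ∎
    where
    open ℕ.≤-Reasoning

    allRunEnds = concatMap (λ v → runEnds (edges (path R v))) (allFin n)

    few-runEnds : ∀ v → length (runEnds (edges (path R v))) ℕ.≤ 2 * suc k
    few-runEnds v =
      ℕ.≤-trans (length-runEnds (edges (path R v))) (ℕ.*-monoʳ-≤ 2 (s≤s (isB v)))

    Realises : Subset n → GridEdge → Set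
    Realises C e = IsMaximalClique G C × Common C e

    realises-injective : ∀ {C D e} → Realises C e → Realises D e → C ≡ D
    realises-injective (mC , eC) (mD , eD) =
      ⊆-antisym (common-determines mD mC eD eC) (common-determines mC mD eC eD)

    realised : ∀ {C} → C List.∈ maximalCliques G → ∃ λ e → e List.∈ allRunEnds × Realises C e
    realised {C} C∈ with ∈-maximalCliques⁻ G C∈
    ... | mC@(cC , _) with maximalClique-nonempty G v₀ mC
      | helly C (λ u v u∈ v∈ u≢v → Equivalence.to (adjacent R u v u≢v) (cC u v u∈ v∈ u≢v))
    ... | v , v∈C | e , eC with common-runEnd v∈C eC
    ... | f , fC , u , f∈ = f , ∈-concatMap⁺ _ (Any.map (λ { refl → f∈ }) (∈-allFin u)) , mC , fC

-- Monotone walks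

infixr 5 _∷_

data Walk : GridPoint → List GridEdge → Set where
  []  : ∀ {p} → Walk p []
  _∷_ : ∀ {p e es} → start e ≡ p → Walk (end e) es → Walk p (e ∷ es)

height-start<end : ∀ e → height (start e) ℤ.< height (end e)
height-start<end e = ℤ.suc[i]≤j⇒i<j (ℤ.≤-reflexive (sym (height-end e)))

height-start≤ : ∀ {q} e → q ∈ᵉ e → height (start e) ℤ.≤ height q
height-start≤ e (inj₁ refl) = ℤ.≤-refl
height-start≤ e (inj₂ refl) = ℤ.<⇒≤ (height-start<end e)

height-≤end : ∀ {q} e → q ∈ᵉ e → height q ℤ.≤ height (end e)
height-≤end e (inj₁ refl) = ℤ.<⇒≤ (height-start<end e)
height-≤end e (inj₂ refl) = ℤ.≤-refl

walk-height : ∀ {p es e} → Walk p es → e List.∈ es → height p ℤ.≤ height (start e)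
walk-height (refl ∷ _)           (here refl) = ℤ.≤-refl
walk-height (_∷_ {e = e} refl w) (there f∈)  =
  ℤ.≤-trans (ℤ.<⇒≤ (height-start<end e)) (walk-height w f∈)

walk-unique : ∀ {p es} → Walk p es → Unique es
walk-unique []                           = []
walk-unique (_∷_ {e = e} {es = es} _ w) = All.tabulate e-fresh ∷ walk-unique w
  where
  e-fresh : ∀ {f} → f List.∈ es → e ≢ f
  e-fresh f∈ refl = ℤ.<⇒≱ (height-start<end e) (walk-height w f∈)

walk-start : ∀ {p es} → Walk p es → ∀ j → toℕ j ≡ 0 → p ≡ start (lookup es j)
walk-start (refl ∷ _) zero _ = refl

walk-consecutive : ∀ {p es} → Walk p es → ∀ i j → toℕ j ≡ suc (toℕ i) →
  end (lookup es i) ≡ start (lookup es j)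
walk-consecutive (_ ∷ w) zero    (suc j) eq = walk-start w j (ℕ.suc-injective eq)
walk-consecutive (_ ∷ w) (suc i) (suc j) eq = walk-consecutive w i j (ℕ.suc-injective eq)

walk-start< : ∀ {p es} → Walk p es → ∀ j → 0 < toℕ j → height p ℤ.< height (start (lookup es j))
walk-start< (_∷_ {e = e} refl w) (suc j) _ =
  ℤ.<-≤-trans (height-start<end e) (walk-height w (∈-lookup j))

walk-nonConsecutive : ∀ {p es} → Walk p es → ∀ i j → suc (toℕ i) < toℕ j →
  height (end (lookup es i)) ℤ.< height (start (lookup es j))
walk-nonConsecutive (_ ∷ w) zero    (suc j) (s≤s 0<j) = walk-start< w j 0<j
walk-nonConsecutive (_ ∷ w) (suc i) (suc j) (s≤s i<j) = walk-nonConsecutive w i j i<j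

-- The only other possible meeting, of `start e` with `end f`, is excluded because their heights
-- differ by two.
end≡start⇒meet-once : ∀ e f → end e ≡ start f → ∀ {q} → q ∈ᵉ e → q ∈ᵉ f → end e ≡ q
end≡start⇒meet-once e f _     (inj₂ q≡end) _             = sym q≡end
end≡start⇒meet-once e f e→f   (inj₁ _)     (inj₁ q≡start) = trans e→f (sym q≡start)
end≡start⇒meet-once e f e→f   (inj₁ refl)  (inj₂ q≡end)  = contradiction
  (ℤ.<-trans (height-start<end e)
    (subst (λ p → height p ℤ.< height (end f)) (sym e→f) (height-start<end f)))
  (ℤ.<-irrefl (cong height q≡end))

walk⇒path : ∀ {p es} → Walk p es → GridPath
walk⇒path {es = es} w = record
  { edges          = es
  ; distinct       = walk-unique w
  ; consecutive    = λ i j j≡1+i →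
      let e→f = walk-consecutive w i j j≡1+i in
      end (lookup es i) , (inj₂ refl , inj₁ e→f) ,
      λ (q∈e , q∈f) → end≡start⇒meet-once (lookup es i) (lookup es j) e→f q∈e q∈f
  -- A shared point would be no higher than the end of the earlier edge and no lower than the start
  -- of the later one.
  ; nonConsecutive = λ i j i<j (q , q∈e , q∈f) →
      ℤ.<⇒≱ (walk-nonConsecutive w i j i<j)
        (ℤ.≤-trans (height-start≤ (lookup es j) q∈f) (height-≤end (lookup es i) q∈e))
  }

-- Staircases

turn : Direction → Direction
turn horizontal = vertical
turn vertical   = horizontal

alternate : ℕ → Direction
alternate zero    = horizontal
alternate (suc i) = turn (alternate i)

-- The point at position a on the line with direction d and coordinate b.
onLine : Direction → ℕ → ℕ → GridPoint
onLine horizontal a b = + a , + b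
onLine vertical   a b = + b , + a

edgeOnLine : Direction → ℕ → ℕ → GridEdge
edgeOnLine d a b = gridEdge d (onLine d a b)

end-edgeOnLine : ∀ d a b → end (edgeOnLine d a b) ≡ onLine d (suc a) b
end-edgeOnLine horizontal a b = refl
end-edgeOnLine vertical   a b = refl

-- A crossing point belongs to two perpendicular lines, with position and coordinate exchanged; this
-- is how consecutive runs are joined.
onLine-turn : ∀ d a b → onLine (turn d) b a ≡ onLine d a b
onLine-turn horizontal a b = refl
onLine-turn vertical   a b = refl

edgeOnLine-injective : ∀ {d d′ a a′ b b′} → edgeOnLine d a b ≡ edgeOnLine d′ a′ b′ → b ≡ b′
edgeOnLine-injective {horizontal} refl = refl
edgeOnLine-injective {vertical}   refl = refl

prependRun : Direction → ℕ → ℕ → ℕ → List GridEdge → List GridEdge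
prependRun d a b zero    es = es
prependRun d a b (suc ℓ) es = edgeOnLine d a b ∷ prependRun d (suc a) b ℓ es

prependRun-walk : ∀ d a b ℓ {es} → Walk (onLine d (a + ℓ) b) es →
  Walk (onLine d a b) (prependRun d a b ℓ es)
prependRun-walk d a b zero    {es} w = subst (λ c → Walk (onLine d c b) es) (ℕ.+-identityʳ a) w
prependRun-walk d a b (suc ℓ) {es} w = refl ∷
  subst (λ p → Walk p (prependRun d (suc a) b ℓ es)) (sym (end-edgeOnLine d a b))
    (prependRun-walk d (suc a) b ℓ (subst (λ c → Walk (onLine d c b) es) (ℕ.+-suc a ℓ) w))

∈-prependRun⁻ : ∀ {e} d a b ℓ {es} → e List.∈ prependRun d a b ℓ es →
  (∃ λ c → e ≡ edgeOnLine d c b) ⊎ e List.∈ es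
∈-prependRun⁻ d a b zero    e∈          = inj₂ e∈
∈-prependRun⁻ d a b (suc ℓ) (here refl) = inj₁ (a , refl)
∈-prependRun⁻ d a b (suc ℓ) (there e∈)  = ∈-prependRun⁻ d (suc a) b ℓ e∈

∈-prependRun⁺ʳ : ∀ {e} d a b ℓ {es} → e List.∈ es → e List.∈ prependRun d a b ℓ es
∈-prependRun⁺ʳ d a b zero    e∈ = e∈
∈-prependRun⁺ʳ d a b (suc ℓ) e∈ = there (∈-prependRun⁺ʳ d (suc a) b ℓ e∈)

∈-prependRun⁺ˡ : ∀ d a b ℓ {c es} → a ℕ.≤ c → c < a + ℓ →
  edgeOnLine d c b List.∈ prependRun d a b ℓ es
∈-prependRun⁺ˡ d a b zero    {c} a≤c c<a+ℓ =
  contradiction a≤c (ℕ.<⇒≱ (subst (c <_) (ℕ.+-identityʳ a) c<a+ℓ))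
∈-prependRun⁺ˡ d a b (suc ℓ) {c} a≤c c<a+ℓ with ℕ.m≤n⇒m<n∨m≡n a≤c
... | inj₁ a<c  = there (∈-prependRun⁺ˡ d (suc a) b ℓ a<c (subst (c <_) (ℕ.+-suc a ℓ) c<a+ℓ))
... | inj₂ refl = here refl

-- The test for a bend between two parallel edges computes only once `d` is a constructor.
countBends-straight : ∀ d a b ℓ es → countBends (prependRun d a b (suc (suc ℓ)) es) ≡
  countBends (prependRun d (suc a) b (suc ℓ) es)
countBends-straight horizontal a b ℓ es = refl
countBends-straight vertical   a b ℓ es = refl

countBends-∷ : ∀ e es → countBends (e ∷ es) ℕ.≤ suc (countBends es)
countBends-∷ e []       = z≤n
countBends-∷ e (f ∷ es) with direction e ≟ᵈ direction f
... | yes _ = ℕ.n≤1+n _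
... | no  _ = ℕ.≤-refl

countBends-prependRun : ∀ d a b ℓ es → countBends (prependRun d a b ℓ es) ℕ.≤ suc (countBends es)
countBends-prependRun d a b zero          es = ℕ.n≤1+n _
countBends-prependRun d a b (suc zero)    es = countBends-∷ _ es
countBends-prependRun d a b (suc (suc ℓ)) es =
  subst (ℕ._≤ _) (sym (countBends-straight d a b ℓ es)) (countBends-prependRun d (suc a) b (suc ℓ) es)

countBends-singleRun : ∀ d a b ℓ → countBends (prependRun d a b ℓ []) ≡ 0
countBends-singleRun d a b zero          = refl
countBends-singleRun d a b (suc zero)    = refl
countBends-singleRun d a b (suc (suc ℓ)) =
  trans (countBends-straight d a b ℓ []) (countBends-singleRun d (suc a) b (suc ℓ))

-- Run i of the staircase lies on the line with coordinate c (i + 1) and leads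
-- from the line with coordinate c i to the one with coordinate c (i + 2).
module Staircase (c : ℕ → ℕ) where

  runs : ℕ → ℕ → List GridEdge
  runs i zero    = []
  runs i (suc m) =
    prependRun (alternate i) (c i) (c (suc i)) (c (suc (suc i)) ∸ c i) (runs (suc i) m)

  runs-walk : (∀ i → c i ℕ.≤ c (suc i)) → ∀ i m →
    Walk (onLine (alternate i) (c i) (c (suc i))) (runs i m)
  runs-walk mono i zero    = []
  runs-walk mono i (suc m) = prependRun-walk _ _ _ _
    (subst (λ p → Walk p (runs (suc i) m)) corner (runs-walk mono (suc i) m))
    where
    -- Monotonicity of `c` makes the truncated difference exact, so run `i` stops at position
    -- `c (i + 2)`, where the next run begins.
    corner : onLine (alternate (suc i)) (c (suc i)) (c (suc (suc i))) ≡
             onLine (alternate i) (c i + (c (suc (suc i)) ∸ c i)) (c (suc i))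
    corner = trans (onLine-turn (alternate i) _ _)
      (cong (λ a → onLine (alternate i) a (c (suc i)))
        (sym (ℕ.m+[n∸m]≡n (ℕ.≤-trans (mono i) (mono (suc i))))))

  ∈-runs⁻ : ∀ {e} i m → e List.∈ runs i m → ∃ λ j → ∃ λ d → ∃ λ a → e ≡ edgeOnLine d a (c (suc j))
  ∈-runs⁻ i (suc m) e∈ with ∈-prependRun⁻ _ _ _ (c (suc (suc i)) ∸ c i) e∈
  ... | inj₁ (a , refl) = i , alternate i , a , refl
  ... | inj₂ e∈′        = ∈-runs⁻ (suc i) m e∈′

  ∈-runs⁺ : ∀ {a} i m j → i ℕ.≤ j → j < i + m → c j ℕ.≤ a → a < c (suc (suc j)) →
    edgeOnLine (alternate j) a (c (suc j)) List.∈ runs i m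
  ∈-runs⁺ i zero    j i≤j j<i+m _ _ =
    contradiction i≤j (ℕ.<⇒≱ (subst (j <_) (ℕ.+-identityʳ i) j<i+m))
  ∈-runs⁺ {a} i (suc m) j i≤j j<i+m cj≤a a<c with ℕ.m≤n⇒m<n∨m≡n i≤j
  ... | inj₁ i<j  = ∈-prependRun⁺ʳ _ _ _ (c (suc (suc i)) ∸ c i)
    (∈-runs⁺ (suc i) m j i<j (subst (j <_) (ℕ.+-suc i m) j<i+m) cj≤a a<c)
  ... | inj₂ refl = ∈-prependRun⁺ˡ _ _ _ _ cj≤a
    -- That the difference is exact follows here from `a` lying between `c i` and `c (i + 2)`.
    (subst (a <_) (sym (ℕ.m+[n∸m]≡n (ℕ.≤-trans cj≤a (ℕ.<⇒≤ a<c)))) a<c)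

  countBends-runs : ∀ i m → countBends (runs i m) ℕ.≤ m ∸ 1
  countBends-runs i zero          = z≤n
  countBends-runs i (suc zero)    = ℕ.≤-reflexive (countBends-singleRun _ _ _ (c (suc (suc i)) ∸ c i))
  countBends-runs i (suc (suc m)) = ℕ.≤-trans
    (countBends-prependRun _ _ _ (c (suc (suc i)) ∸ c i) _) (s≤s (countBends-runs (suc i) (suc m)))

-- Uniqueness of quotient and remainder modulo `suc n`. A coordinate thereby reveals both the index
-- of its run and the offset.
m+kn-injective : ∀ {m m′ k k′ n} → m ℕ.≤ n → m′ ℕ.≤ n →
  m + k * suc n ≡ m′ + k′ * suc n → m ≡ m′ × k ≡ k′
m+kn-injective {m} {m′} {k} {k′} {n} m≤n m′≤n eq =
  m≡m′ , ℕ.*-cancelʳ-≡ k k′ (suc n) (ℕ.+-cancelˡ-≡ m _ _ (trans eq (cong (_+ k′ * suc n) (sym m≡m′))))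
  where
  remainder : ∀ {m} k → m ℕ.≤ n → (m + k * suc n) % suc n ≡ m
  remainder {m} k m≤n = trans ([m+kn]%n≡m%n m k (suc n)) (m<n⇒m%n≡m (s≤s m≤n))
  m≡m′ = trans (sym (remainder k m≤n)) (trans (cong (_% suc n) eq) (remainder k′ m′≤n))

-- The staircase representation

-- Past the end of the list the value ⊥ is still a clique.
nth : ∀ {n} → List (Subset n) → ℕ → Subset n
nth []       _       = ⊥
nth (C ∷ _)  zero    = C
nth (_ ∷ Cs) (suc j) = nth Cs j

∈⇒nth : ∀ {n} {C : Subset n} {Cs} → C List.∈ Cs → ∃ λ j → j < length Cs × nth Cs j ≡ C
∈⇒nth (here refl) = 0 , s≤s z≤n , refl
∈⇒nth (there C∈) with ∈⇒nth C∈
... | j , j< , eq = suc j , s≤s j< , eq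

nth-All : ∀ {n} {P : Subset n → Set} {Cs} → P ⊥ → (∀ {C} → C List.∈ Cs → P C) → ∀ j → P (nth Cs j)
nth-All {Cs = []}     p⊥ pCs j       = p⊥
nth-All {Cs = C ∷ Cs} p⊥ pCs zero    = pCs (here refl)
nth-All {Cs = C ∷ Cs} p⊥ pCs (suc j) = nth-All p⊥ (pCs ∘ there) j

module _ {n : ℕ} (G : Graph n) where
  open Graph G

  -- Zero is the shared value for members; the successor keeps all other vertices off it. The values
  -- fit the remainders modulo `suc n`.
  offset : Fin n → Subset n → ℕ
  offset v S with v ∈? S
  ... | yes _ = 0
  ... | no  _ = suc (toℕ v)

  offset≤n : ∀ v S → offset v S ℕ.≤ n
  offset≤n v S with v ∈? S
  ... | yes _ = z≤n
  ... | no  _ = toℕ<n v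

  ∈⇒offset≡0 : ∀ {v S} → v ∈ S → offset v S ≡ 0
  ∈⇒offset≡0 {v} {S} v∈S with v ∈? S
  ... | yes _  = refl
  ... | no v∉S = contradiction v∈S v∉S

  offset-≡ : ∀ {u v S} → u ≢ v → offset u S ≡ offset v S → u ∈ S × v ∈ S
  offset-≡ {u} {v} {S} u≢v eq with u ∈? S | v ∈? S
  ... | yes u∈S | yes v∈S = u∈S , v∈S
  ... | no  _   | no  _   = contradiction (toℕ-injective (ℕ.suc-injective eq)) u≢v

  clique : ℕ → Subset n
  clique = nth (maximalCliques G)

  clique-isClique : ∀ j → IsClique G (clique j)
  clique-isClique = nth-All (⊥-isClique G) (proj₁ ∘ ∈-maximalCliques⁻ G)

  -- Run j of all members of the j-th clique lies on the line with coordinate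
  -- (j + 1)(n + 1); the other vertices get lines of their own next to it.
  coordinate : Fin n → ℕ → ℕ
  coordinate v zero    = 0
  coordinate v (suc j) = offset v (clique j) + suc j * suc n

  -- Together with the upper bound this confines index `j`, for all vertices, to one block of
  -- `suc n` consecutive numbers. Successive blocks are disjoint, which yields monotone staircases
  -- and overlapping runs.
  coordinate-lower : ∀ v j → j * suc n ℕ.≤ coordinate v j
  coordinate-lower v zero    = z≤n
  coordinate-lower v (suc j) = ℕ.m≤n+m _ (offset v (clique j))

  coordinate-upper : ∀ v j → coordinate v j ℕ.≤ n + j * suc n
  coordinate-upper v zero    = z≤n
  coordinate-upper v (suc j) = ℕ.+-monoˡ-≤ (suc j * suc n) (offset≤n v (clique j))

  coordinate-mono : ∀ v j → coordinate v j ℕ.≤ coordinate v (suc j)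
  coordinate-mono v j = ℕ.≤-trans (coordinate-upper v j)
    (ℕ.≤-trans (ℕ.n≤1+n _) (coordinate-lower v (suc j)))

  open module Stairs v = Staircase (coordinate v)

  staircase : Fin n → GridPath
  staircase v = walk⇒path (runs-walk v (coordinate-mono v) 0 (μ G))

  -- The position is the last number of block `j + 1`. Run `j` of every member starts in block `j`
  -- and ends in block `j + 2`, so it passes through this edge.
  cliqueEdge : ℕ → GridEdge
  cliqueEdge j = edgeOnLine (alternate j) (n + suc j * suc n) (suc j * suc n)

  cliqueEdge-∈ : ∀ {j v} → j < μ G → v ∈ clique j → cliqueEdge j ∈ᵖ staircase v
  cliqueEdge-∈ {j} {v} j<μ v∈ =
    subst (λ o → edgeOnLine (alternate j) _ (o + suc j * suc n) List.∈ runs v 0 (μ G)) (∈⇒offset≡0 v∈)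
      (∈-runs⁺ v 0 (μ G) j z≤n j<μ
        (ℕ.≤-trans (coordinate-upper v j) (ℕ.+-monoʳ-≤ n (ℕ.m≤n+m _ (suc n))))
        -- `suc (suc j) * suc n` unfolds to the successor of the chosen position, so this bound is
        -- already the strict inequality.
        (coordinate-lower v (suc (suc j))))

  -- The reserved line of a maximal clique around `S` supplies the edge. For pairs this gives
  -- adjacency, for arbitrary cliques the Helly property.
  clique-commonEdge : ∀ S → IsClique G S → ∃ λ e → ∀ v → v ∈ S → e ∈ᵖ staircase v
  clique-commonEdge S cS with extendClique G S cS
  ... | C , C∈ , S⊆C with ∈⇒nth C∈
  ... | j , j<μ , refl = cliqueEdge j , λ v v∈S → cliqueEdge-∈ j<μ (S⊆C v∈S)

  pair-isClique : ∀ {u v} → u ~ v → IsClique G (⁅ u ⁆ ∪ ⁅ v ⁆)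
  pair-isClique {u} {v} u~v x y x∈ y∈ x≢y
    with x∈p∪q⁻ ⁅ u ⁆ ⁅ v ⁆ x∈ | x∈p∪q⁻ ⁅ u ⁆ ⁅ v ⁆ y∈
  ... | inj₁ x∈u | inj₁ y∈u = ⁅⁆-isClique G u x y x∈u y∈u x≢y
  ... | inj₂ x∈v | inj₂ y∈v = ⁅⁆-isClique G v x y x∈v y∈v x≢y
  ... | inj₁ x∈u | inj₂ y∈v = subst₂ _~_ (sym (x∈⁅y⁆⇒x≡y u x∈u)) (sym (x∈⁅y⁆⇒x≡y v y∈v)) u~v
  ... | inj₂ x∈v | inj₁ y∈u = subst₂ _~_ (sym (x∈⁅y⁆⇒x≡y v x∈v)) (sym (x∈⁅y⁆⇒x≡y u y∈u)) (~-sym u~v)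

  adjacent⇒share : ∀ {u v} → u ~ v → ShareEdge (staircase u) (staircase v)
  adjacent⇒share {u} {v} u~v with clique-commonEdge (⁅ u ⁆ ∪ ⁅ v ⁆) (pair-isClique u~v)
  ... | e , e-common = e , e-common u (p⊆p∪q ⁅ v ⁆ (x∈⁅x⁆ u)) , e-common v (q⊆p∪q ⁅ u ⁆ ⁅ v ⁆ (x∈⁅x⁆ v))

  -- Equal coordinates force the same run index and equal offsets, which distinct vertices have only
  -- as members of the same clique. The index comes without the bound `μ G`; beyond it `clique` is
  -- `⊥`.
  share⇒adjacent : ∀ {u v} → u ≢ v → ShareEdge (staircase u) (staircase v) → u ~ v
  share⇒adjacent {u} {v} u≢v (e , e∈u , e∈v) with ∈-runs⁻ u 0 (μ G) e∈u | ∈-runs⁻ v 0 (μ G) e∈v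
  ... | j , d , a , refl | j′ , d′ , a′ , eq
    with m+kn-injective {k = suc j} {suc j′} {n} (offset≤n u (clique j)) (offset≤n v (clique j′))
           (edgeOnLine-injective {d} {d′} {a} {a′} eq)
  ... | offsets≡ , refl with offset-≡ u≢v offsets≡
  ... | u∈ , v∈ = clique-isClique j u v u∈ v∈ u≢v

  hasHellyB[μ-1] : HasHellyB G (μ G ∸ 1)
  hasHellyB[μ-1] = R , (λ v → countBends-runs v 0 (μ G)) , helly
    where
    R : EPGRepresentation G
    R = record
      { path     = staircase
      ; adjacent = λ u v u≢v → mk⇔ adjacent⇒share (share⇒adjacent u≢v)
      }

    helly : IsHelly R
    helly S share = clique-commonEdge S λ u v u∈S v∈S u≢v →
      share⇒adjacent u≢v (share u v u∈S v∈S u≢v)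

  -- Extending the empty clique yields a maximal one; hence `μ G ∸ 1` is a true difference.
  0<μ : 0 < μ G
  0<μ = let _ , C∈ , _ = extendClique G ⊥ (⊥-isClique G) in ∈-length C∈

-- Both bounds on the Helly-bend number

theorem3p1 : ∀ (n : ℕ) .{{n≢0 : NonZero n}} (G : Graph n) →
    (∃ λ k → HasHellyB G k) ×
    (∀ b → IsHellyBendNumber G b →
    (((+ μ G / (2 * n)) {{m*n≢0 2 n}} - 1ℚ) ≤ (+ b / 1)) ×
    ((+ b / 1) ≤ ((+ μ G / 1) - 1ℚ)))
theorem3p1 n@(suc _) G = (μ G ∸ 1 , hasHellyB[μ-1] G) , bounds
  where
  bounds : ∀ b → IsHellyBendNumber G b → _
  bounds b ((R , isB , helly) , least) =
    p≤1+q⇒p-1≤q (subst (_ ≤_) (sym (1+[b/1]≡[1+b]/1 b)) (/-mono-≤ (μ G) (suc b) (2 * n) 1 lower)) ,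
    1+q≤p⇒q≤p-1 (subst (_≤ _) (sym (1+[b/1]≡[1+b]/1 b)) (/-mono-≤ (suc b) (μ G) 1 1 upper))
    where
    lower : μ G * 1 ℕ.≤ suc b * (2 * n)
    lower = subst₂ ℕ._≤_ (sym (ℕ.*-identityʳ (μ G))) (ℕ.*-comm (2 * n) (suc b))
      -- `zero` is the vertex that the counting argument asks for; it exists since `n` is a
      -- successor.
      (μ≤2n[k+1] R zero isB helly)

    upper : suc b * 1 ℕ.≤ μ G * 1
    upper = ℕ.*-monoˡ-≤ 1 (subst (suc b ℕ.≤_) (ℕ.m+[n∸m]≡n (0<μ G))
      (s≤s (least (μ G ∸ 1) (hasHellyB[μ-1] G))))
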